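{- Let $I$ be an ideal on a cardinal $\kappa$ and let $\theta<\kappa$ be a regular cardinal. The following are equivalent: (1) $I$ is weakly $\theta$-saturated and $\theta$-indecomposable. (2) Whenever $\langle B_i:i<\theta\rangle$ is a $\subseteq$-increasing sequence of subsets of $\kappa$, there is $i^*<\theta$ such that $B_i=_I\bigcup_{j<\theta}B_j$ for all $i$ with $i^*\leq i<\theta$. (3) Whenever $\langle A_i:i<\theta\rangle$ is a sequence of $I$-positive subsets of $\kappa$, we have $\bigcap_{i<\theta}\bigcup_{i\leq j<\theta}A_j\neq\emptyset$. (4) If $\langle S_\alpha:\alpha<\kappa\rangle$ is a sequence of sets of ordinals with $|S_\alpha|<\theta$ for all $\alpha$, then every sequence $\langle h_i:i<\theta\rangle$ of functions in $\prod_{\alpha<\kappa}S_\alpha$ that is increasing in the pointwise order ($i<j$ implies $h_i(\alpha)\leq h_j(\alpha)$ for all $\alpha$) is eventually constant modulo $I$, i.e. there is $i^*<\theta$ with $h_i=_I h_{i^*}$ for all $i\geq i^*$. (5) Every function $f:\kappa\to\theta$ is bounded below $\theta$ almost everywhere, i.e. there is $\beta<\theta$ with $\{\alpha<\kappa: f(\alpha)\geq\beta\}\in I$.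
   Context: By an ideal on a cardinal $\kappa$ we mean a proper ideal on $\kappa$ containing all bounded subsets of $\kappa$. A set is $I$-positive if it is not in $I$. $A=_I B$ means $A\setminus B\in I$ and $B\setminus A\in I$; for functions, $f=_I g$ means $\{\alpha:f(\alpha)\neq g(\alpha)\}\in I$. $I$ is weakly $\theta$-saturated if there is no partition of $\kappa$ into $\theta$ pairwise disjoint $I$-positive sets. $I$ is $\theta$-indecomposable if whenever $\langle A_i:i<\theta\rangle$ are subsets of $\kappa$ with $\bigcup_{i<\theta}A_i\notin I$, there is $w\subseteq\theta$ with $|w|<\theta$ and $\bigcup_{i\in w}A_i\notin I$. -}

module Defs where

open import Level using (Level; suc; _⊔_)
open import Data.Nat.Base using (ℕ)
open import Data.Product.Base using (Σ; ∃; Σ-syntax; ∃-syntax; _×_; proj₁)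
open import Function.Base using (_on_)
open import Function.Bundles using (Func; Bijection; _↣_)
open import Induction.WellFounded using (WellFounded)
open import Relation.Binary.Bundles using (Setoid)
open import Relation.Binary.Core using (Rel)
open import Relation.Binary.Morphism.Structures using (IsOrderIsomorphism)
open import Relation.Binary.PropositionalEquality.Core using (_≡_; _≢_)
open import Relation.Binary.PropositionalEquality.Properties using (setoid)
open import Relation.Binary.Structures using (IsStrictTotalOrder)
open import Relation.Nullary.Negation.Core using (¬_)
open import Relation.Unary
  using (Pred; _∈_; _∉_; _⊆_; _∪_; _∖_; _⊥_; ⋃; ⋂; Satisfiable; Universal)
open import Relation.Unary.Polymorphic using (∅; U)
import Relation.Binary.Construct.On as On
import Relation.Binary.Construct.StrictToNonStrict as NonStrict

private
  variable
    ℓ i : Level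

-- An ordinal is represented by a well-ordered type: the elements of the
-- carrier are the smaller ordinals.
record Ordinal (ℓ : Level) : Set (suc ℓ) where
  infix 4 _<_
  field
    Carrier            : Set ℓ
    _<_                : Rel Carrier ℓ
    isStrictTotalOrder : IsStrictTotalOrder _≡_ _<_
    wellFounded        : WellFounded _<_

  open NonStrict _≡_ _<_ public using (_≤_)

open Ordinal using (Carrier)

-- Elements are compared by their first components only, so that the proofs of
-- membership (which need not be unique) do not affect cardinalities.
subset : {X : Set ℓ} → Pred X ℓ → Setoid ℓ ℓ
subset {X = X} A = On.setoid (setoid X) (proj₁ {A = X} {B = A})

Below : (α : Ordinal ℓ) → Carrier α → Pred (Carrier α) ℓ
Below α β γ = γ < β where open Ordinal α

infix 4 ∣_∣<_

-- S is equinumerous with some ordinal smaller than α.  When α is a cardinal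
-- this says that the cardinality of S is less than α.
∣_∣<_ : Setoid ℓ ℓ → Ordinal ℓ → Set ℓ
∣ S ∣< α = ∃[ β ] Bijection S (subset (Below α β))

IsCardinal : Ordinal ℓ → Set ℓ
IsCardinal α = ¬ (∣ setoid (Carrier α) ∣< α)

Cofinal : (α : Ordinal ℓ) {S : Setoid ℓ ℓ} → Func S (setoid (Carrier α)) → Set ℓ
Cofinal α {S} f = ∀ β → Σ[ x ∈ Setoid.Carrier S ] β ≤ Func.to f x
  where open Ordinal α

-- An infinite cardinal equal to its cofinality.
record IsRegularCardinal (θ : Ordinal ℓ) : Set ℓ where
  field
    isCardinal : IsCardinal θ
    infinite   : ℕ ↣ Carrier θ
    regular    : ∀ β (f : Func (subset (Below θ β)) (setoid (Carrier θ))) →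
                 ¬ Cofinal θ f

infix 4 _<ₒ_

-- α is order-isomorphic to a proper initial segment of β.
_<ₒ_ : Ordinal ℓ → Ordinal ℓ → Set ℓ
α <ₒ β = Σ[ b ∈ Carrier β ] Σ[ f ∈ (Carrier α → Σ (Carrier β) (Below β b)) ]
  IsOrderIsomorphism _≡_ (_≡_ on proj₁) (Ordinal._<_ α) (Ordinal._<_ β on proj₁) f

-- Closure under subsets makes membership in I depend only on the extension
-- of a predicate.
record IsIdeal (κ : Ordinal ℓ) (I : Pred (Pred (Carrier κ) ℓ) i) :
               Set (suc ℓ ⊔ i) where
  field
    empty     : ∅ ∈ I
    downward  : ∀ {A B} → A ⊆ B → B ∈ I → A ∈ I
    union     : ∀ {A B} → A ∈ I → B ∈ I → A ∪ B ∈ I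
    proper    : U ∉ I
    bounded   : ∀ {A} β → A ⊆ Below κ β → A ∈ I

module _ {X : Set ℓ} (I : Pred (Pred X ℓ) i) where

  Positive : Pred X ℓ → Set i
  Positive A = A ∉ I

  EqualMod : Pred X ℓ → Pred X ℓ → Set i
  EqualMod A B = (A ∖ B ∈ I) × (B ∖ A ∈ I)

  FunEqualMod : {Y : Set ℓ} → (X → Y) → (X → Y) → Set i
  FunEqualMod f g = (λ x → f x ≢ g x) ∈ I

module _ (κ θ : Ordinal ℓ) (I : Pred (Pred (Carrier κ) ℓ) i) where

  open Ordinal θ using (_<_; _≤_)

  private
    K = Carrier κ
    T = Carrier θ

  WeaklySaturated : Set (suc ℓ ⊔ i)
  WeaklySaturated = ¬ (Σ[ P ∈ (T → Pred K ℓ) ]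
    (∀ ξ → Positive I (P ξ)) ×
    (∀ ξ η → ξ ≢ η → P ξ ⊥ P η) ×
    Universal (⋃ T P))

  Indecomposable : Set (suc ℓ ⊔ i)
  Indecomposable = (A : T → Pred K ℓ) → ⋃ T A ∉ I →
    Σ[ w ∈ Pred T ℓ ] (∣ subset w ∣< θ) × (⋃[ ξ ∶ Σ T w ] A (proj₁ ξ)) ∉ I

  IncreasingSequencesStabilise : Set (suc ℓ ⊔ i)
  IncreasingSequencesStabilise = (B : T → Pred K ℓ) →
    (∀ {ξ η} → ξ < η → B ξ ⊆ B η) →
    ∃[ ξ* ] (∀ ξ → ξ* ≤ ξ → EqualMod I (B ξ) (⋃ T B))

  PositiveSequencesRecur : Set (suc ℓ ⊔ i)
  PositiveSequencesRecur = (A : T → Pred K ℓ) → (∀ ξ → Positive I (A ξ)) →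
    Satisfiable (⋂[ ξ ∶ T ] ⋃[ η ∶ Σ T (ξ ≤_) ] A (proj₁ η))

  -- A set-indexed family of sets of ordinals lies below a common ordinal Ω.
  IncreasingFunctionsStabilise : Set (suc ℓ ⊔ i)
  IncreasingFunctionsStabilise =
    (Ω : Ordinal ℓ) (S : K → Pred (Carrier Ω) ℓ) → (∀ α → ∣ subset (S α) ∣< θ) →
    (h : T → K → Carrier Ω) → (∀ ξ α → h ξ α ∈ S α) →
    (∀ {ξ η} → ξ < η → ∀ α → Ordinal._≤_ Ω (h ξ α) (h η α)) →
    ∃[ ξ* ] (∀ ξ → ξ* ≤ ξ → FunEqualMod I (h ξ) (h ξ*))

  FunctionsBounded : Set (ℓ ⊔ i)
  FunctionsBounded = (f : K → T) → ∃[ β ] ((λ α → β ≤ f α) ∈ I)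

{-# OPTIONS --safe #-}

-- Every condition is compared with (5).  From (5), each of the other conditions
-- follows by choosing for every α < κ a suitable index f(α) < θ: the piece or the
-- first sets containing α, an index past which α no longer occurs, or a stage
-- from which h_i(α) is constant (it exists since θ is regular and |S_α| < θ).
-- Conversely, f : κ → θ is tested with B_i = {f ≤ i} in (2), A_i = {f ≥ i} in (3)
-- and h_i = min(i, f) in (4).  For (1), let f be unbounded modulo I.  By
-- indecomposability and regularity, each {β ≤ f} contains a positive interval
-- {β ≤ f < g(β)}; iterating g with suprema along θ gives θ disjoint positive
-- intervals, contradicting weak saturation.

module Submission where

open import Defs
open import Level using (Level; _⊔_)
open import Axiom.DoubleNegationElimination using (em⇒dne)
open import Axiom.ExcludedMiddle using (ExcludedMiddle)
open import Data.Empty using (⊥-elim)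
open import Data.Product.Base using (Σ; ∃; Σ-syntax; ∃-syntax; _×_; _,_; proj₁; proj₂)
open import Data.Sum.Base using (inj₁; inj₂)
open import Function.Base using (_∘_; id)
open import Function.Bundles using (Func; Bijection; Inverse; Injection; _⇔_; mk⇔)
open import Function.Properties.Bijection using (Bijection⇒Inverse)
import Function.Construct.Composition as Composition
import Function.Construct.Identity as Identity
import Function.Construct.Symmetry as Symmetry
open import Induction.WellFounded using (WfRec; module All; module FixPoint)
open import Relation.Binary.Bundles using (Setoid)
open import Relation.Binary.Definitions using (tri<; tri≈; tri>)
open import Relation.Binary.PropositionalEquality
  using (_≡_; refl; sym; trans; cong; subst; setoid)
open import Relation.Binary.Structures using (IsStrictTotalOrder)
open import Relation.Nullary.Decidable.Core using (yes; no)
open import Relation.Nullary.Negation.Core using (¬_)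
open import Relation.Unary using (Pred; _∈_; _⊆_; _∪_; Satisfiable; ⋃)

private
  variable
    ℓ i a p : Level

-- Order facts and minima in an ordinal.

module OrdinalProperties (α : Ordinal ℓ) where
  open Ordinal α public
  open IsStrictTotalOrder isStrictTotalOrder public
    using (compare; irrefl) renaming (trans to <-trans)

  ≤-<-trans : ∀ {x y z} → x ≤ y → y < z → x < z
  ≤-<-trans (inj₁ x<y)  y<z = <-trans x<y y<z
  ≤-<-trans (inj₂ refl) y<z = y<z

  <-≤-trans : ∀ {x y z} → x < y → y ≤ z → x < z
  <-≤-trans x<y (inj₁ y<z)  = <-trans x<y y<z
  <-≤-trans x<y (inj₂ refl) = x<y

  <⇒≱ : ∀ {x y} → x < y → ¬ y ≤ x
  <⇒≱ x<y y≤x = irrefl refl (<-≤-trans x<y y≤x)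

  ≮⇒≥ : ∀ {x y} → ¬ x < y → y ≤ x
  ≮⇒≥ {x} {y} x≮y with compare x y
  ... | tri< x<y _ _ = ⊥-elim (x≮y x<y)
  ... | tri≈ _ refl _ = inj₂ refl
  ... | tri> _ _ y<x = inj₁ y<x

  ≰⇒> : ∀ {x y} → ¬ x ≤ y → y < x
  ≰⇒> {x} {y} x≰y with compare x y
  ... | tri< x<y _ _ = ⊥-elim (x≰y (inj₁ x<y))
  ... | tri≈ _ x≡y _ = ⊥-elim (x≰y (inj₂ x≡y))
  ... | tri> _ _ y<x = y<x

  ≤-antisym : ∀ {x y} → x ≤ y → y ≤ x → x ≡ y
  ≤-antisym (inj₂ x≡y) _ = x≡y
  ≤-antisym (inj₁ x<y) y≤x = ⊥-elim (<⇒≱ x<y y≤x)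

  infixl 7 _⊓_

  _⊓_ : Carrier → Carrier → Carrier
  x ⊓ y with compare x y
  ... | tri< _ _ _ = x
  ... | tri≈ _ _ _ = x
  ... | tri> _ _ _ = y

  x⊓y≤y : ∀ x y → x ⊓ y ≤ y
  x⊓y≤y x y with compare x y
  ... | tri< x<y _ _ = inj₁ x<y
  ... | tri≈ _ x≡y _ = inj₂ x≡y
  ... | tri> _ _ _ = inj₂ refl

  x⊓y≤x : ∀ x y → x ⊓ y ≤ x
  x⊓y≤x x y with compare x y
  ... | tri< _ _ _ = inj₂ refl
  ... | tri≈ _ _ _ = inj₂ refl
  ... | tri> _ _ y<x = inj₁ y<x

  x≤y⇒x⊓y≡x : ∀ {x y} → x ≤ y → x ⊓ y ≡ x
  x≤y⇒x⊓y≡x {x} {y} x≤y with compare x y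
  ... | tri< _ _ _ = refl
  ... | tri≈ _ _ _ = refl
  ... | tri> _ _ y<x = ⊥-elim (<⇒≱ y<x x≤y)

  ⊓-monoˡ-< : ∀ {x y} z → x < y → x ⊓ z ≤ y ⊓ z
  ⊓-monoˡ-< {x} {y} z x<y with compare y z
  ... | tri< _ _ _ = inj₁ (≤-<-trans (x⊓y≤x x z) x<y)
  ... | tri≈ _ _ _ = inj₁ (≤-<-trans (x⊓y≤x x z) x<y)
  ... | tri> _ _ _ = x⊓y≤y x z

module _ (em : ∀ {a} → ExcludedMiddle a) where

  -- Classical choice and least elements.

  dne : {P : Set a} → ¬ ¬ P → P
  dne = em⇒dne em

  ¬∀⇒∃¬ : {X : Set a} {P : Pred X p} → ¬ (∀ x → P x) → ∃[ x ] ¬ P x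
  ¬∀⇒∃¬ ¬∀ = dne λ ¬∃ → ¬∀ λ x → dne λ ¬Px → ¬∃ (x , ¬Px)

  -- Deciding `Satisfiable (R x)` positively yields a witness itself, since existence is a Σ-type;
  -- `y₀` is the default where `R x` is empty.
  choice : {X : Set a} {Y : Set ℓ} → Y → (R : X → Pred Y p) →
           ∃[ f ] ∀ x → Satisfiable (R x) → R x (f x)
  choice {X = X} {Y = Y} y₀ R = (λ x → proj₁ (pick x)) , λ x → proj₂ (pick x)
    where
    pick : ∀ x → Σ[ y ∈ Y ] (Satisfiable (R x) → R x y)
    pick x with em {P = Satisfiable (R x)}
    ... | yes (y , r) = y , λ _ → r
    ... | no ¬r = y₀ , λ r → ⊥-elim (¬r r)

  module Least (α : Ordinal ℓ) (x₀ : Ordinal.Carrier α) where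
    open OrdinalProperties α

    IsLeast : Pred Carrier p → Pred Carrier (ℓ ⊔ p)
    IsLeast P x = P x × (∀ {y} → P y → x ≤ y)

    least : (P : Pred Carrier p) → Satisfiable P → ∃ (IsLeast P)
    least {p} P (x , Px) = All.wfRec wellFounded _ (λ x → P x → ∃ (IsLeast P)) step x Px
      where
      step : ∀ x → WfRec _<_ (λ x → P x → ∃ (IsLeast P)) x → P x → ∃ (IsLeast P)
      step x IH Px with em {P = ∃[ y ] (y < x × P y)}
      ... | yes (y , y<x , Py) = IH y<x Py
      ... | no ¬smaller = x , Px , λ Py → ≮⇒≥ λ y<x → ¬smaller (_ , y<x , Py)

    -- The junk value μ P = x₀ is taken on the empty predicate.
    μ : Pred Carrier p → Carrier
    μ P with em {P = Satisfiable P}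
    ... | yes sat = proj₁ (least P sat)
    ... | no _ = x₀

    μ-satisfies : (P : Pred Carrier p) → Satisfiable P → μ P ∈ P
    μ-satisfies P sat with em {P = Satisfiable P}
    ... | yes sat′ = proj₁ (proj₂ (least P sat′))
    ... | no ¬sat = ⊥-elim (¬sat sat)

    μ-cong : {P Q : Pred Carrier p} → P ⊆ Q → Q ⊆ P → μ P ≡ μ Q
    μ-cong {P = P} {Q} P⊆Q Q⊆P with em {P = Satisfiable P} | em {P = Satisfiable Q}
    ... | no _ | no _ = refl
    ... | yes (x , Px) | no ¬Q = ⊥-elim (¬Q (x , P⊆Q Px))
    ... | no ¬P | yes (x , Qx) = ⊥-elim (¬P (x , Q⊆P Qx))
    ... | yes satP | yes satQ with least P satP | least Q satQ
    ...   | x , Px , x≤ | y , Qy , y≤ = ≤-antisym (x≤ (Q⊆P Qy)) (y≤ (P⊆Q Px))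

  -- Bounds and recursion below a regular cardinal.

  module RegularCardinal (θ : Ordinal ℓ) (θ-regular : IsRegularCardinal θ) where
    open OrdinalProperties θ
    open IsRegularCardinal θ-regular

    -- Regularity concerns initial segments of `θ`; a bijection with such a segment transports it to
    -- `S`. A point witnessing non-cofinality is a strict bound.
    bounded-image : {S : Setoid ℓ ℓ} → ∣ S ∣< θ → (f : Func S (setoid Carrier)) →
                    ∃[ δ ] ∀ x → Func.to f x < δ
    bounded-image {S} (β , S≅β) f = δ , bound
      where
      open Inverse (Bijection⇒Inverse S≅β)
        using (to; from; from-cong; strictlyInverseʳ)

      enumeration : Func (subset (Below θ β)) (setoid Carrier)
      enumeration = record
        { to = Func.to f ∘ from ; cong = Func.cong f ∘ from-cong }

      not-dominated : ∃[ δ ] ¬ (Σ[ x ∈ Setoid.Carrier (subset (Below θ β)) ]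
                                  δ ≤ Func.to enumeration x)
      not-dominated = ¬∀⇒∃¬ (regular β enumeration)

      δ = proj₁ not-dominated

      bound : ∀ x → Func.to f x < δ
      bound x = subst (_< δ) (Func.cong f (strictlyInverseʳ x))
                  (≰⇒> λ δ≤ → proj₂ not-dominated (to x , δ≤))

    ∣Below∣< : ∀ β → ∣ subset (Below θ β) ∣< θ
    ∣Below∣< β = β , Identity.bijection _

    x₀ : Carrier
    x₀ = Injection.to infinite 0

    has-predecessor : ∃[ x ] ∃[ y ] x < y
    has-predecessor with compare (Injection.to infinite 0) (Injection.to infinite 1)
    ... | tri< x<y _ _ = _ , _ , x<y
    ... | tri> _ _ y<x = _ , _ , y<x
    ... | tri≈ _ x≡y _ with () ← Injection.injective infinite x≡y

    -- The constant function `β` on a nonempty initial segment has a strict bound.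
    unbounded : ∀ β → ∃[ δ ] β < δ
    unbounded β with has-predecessor
    ... | x , y , x<y with bounded-image (∣Below∣< y) (record { to = λ _ → β ; cong = λ _ → refl })
    ... | δ , β<δ = δ , β<δ (x , x<y)

    -- For each value `s`, pick a stage where `h` exceeds `s`, if there is one. As `S` is small,
    -- some `δ` bounds these stages. Growth after `δ` would mean that `h δ` was already exceeded
    -- before `δ`, against monotonicity.
    monotone⇒eventually-constant :
      (Ω : Ordinal ℓ) (S : Pred (Ordinal.Carrier Ω) ℓ) → ∣ subset S ∣< θ →
      (h : Carrier → Ordinal.Carrier Ω) → (∀ ξ → h ξ ∈ S) →
      (∀ {ξ η} → ξ < η → Ordinal._≤_ Ω (h ξ) (h η)) →
      ∃[ δ ] ∀ η → δ ≤ η → h η ≡ h δ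
    monotone⇒eventually-constant Ω S ∣S∣<θ h h∈S h-mono = δ , λ
      { η (inj₁ δ<η)  → dne λ hη≢hδ →
          let hδ<hη = Ω.≰⇒> (λ hη≤hδ → hη≢hδ (Ω.≤-antisym hη≤hδ (h-mono δ<η)))
          in Ω.<⇒≱ (exceeds (h δ) (η , hδ<hη)) (h-mono (exit<δ (h δ , h∈S δ)))
      ; η (inj₂ refl) → refl }
      where
      module Ω = OrdinalProperties Ω

      exits : ∃[ e ] ∀ s → ∃[ ξ ] s Ω.< h ξ → s Ω.< h (e s)
      exits = choice x₀ (λ s ξ → s Ω.< h ξ)

      exceeds = proj₂ exits

      exit-bound : ∃[ δ ] ∀ (s : Σ Ω.Carrier S) → proj₁ exits (proj₁ s) < δ
      exit-bound = bounded-image ∣S∣<θ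
        (record { to = proj₁ exits ∘ proj₁ ; cong = cong (proj₁ exits) })

      δ = proj₁ exit-bound
      exit<δ = proj₂ exit-bound

    module Iteration (g : Carrier → Carrier) where
      open Least θ x₀

      -- Minimality makes the value depend only on the graph of the earlier
      -- values, which is what unfolding the recursion requires.
      step : ∀ ξ → WfRec _<_ (λ _ → Carrier) ξ → Carrier
      step ξ earlier = μ (λ δ → ∀ {η} (η<ξ : η < ξ) → g (earlier η<ξ) < δ)

      step-ext : ∀ ξ {e e′ : WfRec _<_ (λ _ → Carrier) ξ} →
                 (∀ {η} (η<ξ : η < ξ) → e η<ξ ≡ e′ η<ξ) → step ξ e ≡ step ξ e′
      step-ext ξ e≡e′ = μ-cong
        (λ {δ} below η<ξ → subst (λ x → g x < δ) (e≡e′ η<ξ) (below η<ξ))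
        (λ {δ} below η<ξ → subst (λ x → g x < δ) (sym (e≡e′ η<ξ)) (below η<ξ))

      iterate : Carrier → Carrier
      iterate = All.wfRec wellFounded _ (λ _ → Carrier) step

      -- Regularity bounds the values of `g` at the earlier iterates, so the predicate minimised in
      -- `step` is satisfiable and `μ` satisfies it.
      iterate-< : ∀ {η ξ} → η < ξ → g (iterate η) < iterate ξ
      iterate-< {η} {ξ} η<ξ = subst (g (iterate η) <_)
        (sym (FixPoint.unfold-wfRec wellFounded (λ _ → Carrier) step step-ext {ξ}))
        (μ-satisfies (λ δ → ∀ {η} → η < ξ → g (iterate η) < δ)
          (proj₁ bound , λ {η} η<ξ → proj₂ bound (η , η<ξ)) η<ξ)
        where
        bound : ∃[ δ ] ∀ (x : Σ Carrier (Below θ ξ)) → g (iterate (proj₁ x)) < δ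
        bound = bounded-image (∣Below∣< ξ)
          (record { to = g ∘ iterate ∘ proj₁ ; cong = cong (g ∘ iterate) })

  module Equivalences (κ θ : Ordinal ℓ) (θ-regular : IsRegularCardinal θ)
                      (I : Pred (Pred (Ordinal.Carrier κ) ℓ) i) (I-ideal : IsIdeal κ I) where
    open OrdinalProperties θ
    open RegularCardinal θ θ-regular
    open IsIdeal I-ideal hiding (bounded)

    -- Condition (1) and bounded functions.

    bounded⇒saturated : FunctionsBounded κ θ I → WeaklySaturated κ θ I
    bounded⇒saturated bdd (P , positive , disjoint , cover)
      with bdd (proj₁ ∘ cover)
    ... | β , small = positive β (downward P⊆ small)
      where
      P⊆ : P β ⊆ λ α → β ≤ proj₁ (cover α)
      P⊆ {α} Pβα = inj₂ (dne λ β≢ → disjoint _ _ β≢ (Pβα , proj₂ (cover α)))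

    bounded⇒indecomposable : FunctionsBounded κ θ I → Indecomposable κ θ I
    bounded⇒indecomposable bdd A ⋃A∉I
      with choice x₀ (λ α ξ → A ξ α)
    ... | f , f-index with bdd f
    -- Points of the union whose chosen index is not below `β` form a small set, so the indices
    -- below `β` suffice.
    ... | β , small = Below θ β , ∣Below∣< β , λ ⋃∈I → ⋃A∉I (downward split (union ⋃∈I small))
      where
      split : ⋃ Carrier A ⊆ (⋃ (Σ Carrier (Below θ β)) (A ∘ proj₁)) ∪ (λ α → β ≤ f α)
      split {α} α∈⋃ with em {P = f α < β}
      ... | yes f<β = inj₁ ((f α , f<β) , f-index α α∈⋃)
      ... | no f≮β = inj₂ (≮⇒≥ f≮β)

    -- Split `{β ≤ f}` into fibres of `f`: indecomposability keeps fewer than `θ` of them with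
    -- positive union, and regularity bounds their indices.
    indecomposable⇒positive-interval :
      Indecomposable κ θ I → (f : Ordinal.Carrier κ → Carrier) →
      ∀ {β} → Positive I (λ α → β ≤ f α) →
      ∃[ δ ] Positive I (λ α → β ≤ f α × f α < δ)
    indecomposable⇒positive-interval ind f {β} positive
      with ind (λ ξ α → β ≤ f α × f α ≡ ξ)
               (λ ⋃∈I → positive (downward (λ β≤f → _ , β≤f , refl) ⋃∈I))
    ... | w , ∣w∣<θ , ⋃w∉I with bounded-image ∣w∣<θ (record { to = proj₁ ; cong = id })
    ... | δ , w<δ = δ , λ small →
      ⋃w∉I (downward (λ { (ξ , β≤f , refl) → β≤f , w<δ ξ }) small)

    -- Weak saturation concerns partitions of all of `κ`. The points outside every `Q ξ` get the
    -- default index `x₀`, which only enlarges one piece.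
    disjoint-positive⇒¬saturated :
      (Q : Carrier → Pred (Ordinal.Carrier κ) ℓ) → (∀ ξ → Positive I (Q ξ)) →
      (∀ {ξ η α} → Q ξ α → Q η α → ξ ≡ η) → ¬ WeaklySaturated κ θ I
    disjoint-positive⇒¬saturated Q positive unique saturated
      with choice x₀ (λ α ξ → Q ξ α)
    ... | f , f-index = saturated
      ( (λ ξ α → f α ≡ ξ)
      , (λ ξ small → positive ξ
           (downward (λ {α} Qα → unique (f-index α (ξ , Qα)) Qα) small))
      , (λ { ξ η ξ≢η (refl , refl) → ξ≢η refl })
      , (λ α → f α , refl))

    saturated×indecomposable⇒bounded :
      WeaklySaturated κ θ I × Indecomposable κ θ I → FunctionsBounded κ θ I
    saturated×indecomposable⇒bounded (saturated , ind) f = dne λ ¬bdd →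
      let interval = λ β → indecomposable⇒positive-interval ind f
                             (λ small → ¬bdd (β , small))
          -- `iterate ξ` is the left endpoint of the interval numbered `ξ`, chosen beyond the right
          -- endpoints of all earlier ones.
          open Iteration (proj₁ ∘ interval)
          separated : ∀ {ξ η α} → ξ < η → f α < proj₁ (interval (iterate ξ)) →
                      ¬ iterate η ≤ f α
          separated ξ<η f< = <⇒≱ (<-trans f< (iterate-< ξ<η))
          unique : ∀ {ξ η α} →
                   iterate ξ ≤ f α × f α < proj₁ (interval (iterate ξ)) →
                   iterate η ≤ f α × f α < proj₁ (interval (iterate η)) → ξ ≡ η
          unique = λ { (lo , hi) (lo′ , hi′) → ≤-antisym
            (≮⇒≥ λ η<ξ → separated η<ξ hi′ lo) (≮⇒≥ λ ξ<η → separated ξ<η hi lo′) }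
      in disjoint-positive⇒¬saturated _ (λ ξ → proj₂ (interval (iterate ξ))) unique saturated

    -- Conditions (2), (3) and (4) and bounded functions.

    bounded⇒stabilise : FunctionsBounded κ θ I → IncreasingSequencesStabilise κ θ I
    bounded⇒stabilise bdd B B-mono with choice x₀ (λ α ξ → B ξ α)
    ... | f , f-index with bdd f
    ... | β , small = β , λ ξ β≤ξ →
        downward (λ { (Bα , ∉⋃) → ⊥-elim (∉⋃ (ξ , Bα)) }) empty
      -- A point that has entered by a stage below `β` stays in every later set.
      , downward (λ { {α} (α∈⋃ , ∉Bξ) → ≮⇒≥ λ f<β →
                   ∉Bξ (B-mono (<-≤-trans f<β β≤ξ) (f-index α α∈⋃)) }) small

    stabilise⇒bounded : IncreasingSequencesStabilise κ θ I → FunctionsBounded κ θ I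
    stabilise⇒bounded stab f
      with stab (λ ξ α → f α ≤ ξ) (λ ξ<η f≤ξ → inj₁ (≤-<-trans f≤ξ ξ<η))
    -- The union is all of `κ`, so `{f > ξ}` is small; a strict bound `β` of `ξ` turns `β ≤ f` into
    -- `ξ < f`.
    ... | ξ , eq with unbounded ξ
    ... | β , ξ<β = β , downward
      (λ {α} β≤f → (f α , inj₂ refl) , <⇒≱ (<-≤-trans ξ<β β≤f))
      (proj₂ (eq ξ (inj₂ refl)))

    bounded⇒recur : FunctionsBounded κ θ I → PositiveSequencesRecur κ θ I
    bounded⇒recur bdd A positive = dne λ ¬sat →
      -- From index `last α` on, `α` lies in no set of the sequence.
      let last = λ α → ¬∀⇒∃¬ (λ all → ¬sat (α , all))
          (β , small) = bdd (proj₁ ∘ last)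
      in positive β (downward
           (λ {α} Aβα → ≮⇒≥ λ last<β → proj₂ (last α) ((β , inj₁ last<β) , Aβα)) small)

    recur⇒bounded : PositiveSequencesRecur κ θ I → FunctionsBounded κ θ I
    recur⇒bounded recur f = dne λ ¬bdd →
      let (α , rec) = recur (λ ξ α → ξ ≤ f α) (λ ξ small → ¬bdd (ξ , small))
          (δ , f<δ) = unbounded (f α)
          ((η , δ≤η) , η≤f) = rec δ
      in <⇒≱ (<-≤-trans f<δ δ≤η) η≤f

    bounded⇒constant : FunctionsBounded κ θ I → IncreasingFunctionsStabilise κ θ I
    bounded⇒constant bdd Ω S ∣S∣<θ h h∈S h-mono = β , λ ξ β≤ξ → downward
        (λ {α} hξ≢hβ → ≮⇒≥ λ f<β → hξ≢hβ
          (trans (proj₂ (stage α) ξ (inj₁ (<-≤-trans f<β β≤ξ)))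
                 (sym (proj₂ (stage α) β (inj₁ f<β)))))
        (proj₂ (bdd (proj₁ ∘ stage)))
      where
      stage : ∀ α → ∃[ δ ] ∀ η → δ ≤ η → h η α ≡ h δ α
      stage α = monotone⇒eventually-constant Ω (S α) (∣S∣<θ α)
        (λ ξ → h ξ α) (λ ξ → h∈S ξ α) (λ ξ<η → h-mono ξ<η α)

      β = proj₁ (bdd (proj₁ ∘ stage))

    constant⇒bounded : IncreasingFunctionsStabilise κ θ I → FunctionsBounded κ θ I
    constant⇒bounded const f
      -- All `ξ ⊓ f α` lie below a strict bound of `f α`, hence in an initial segment of size less
      -- than `θ`.
      with const θ (λ α → Below θ (proj₁ (unbounded (f α)))) (λ α → ∣Below∣< _)
             (λ ξ α → ξ ⊓ f α)
             (λ ξ α → ≤-<-trans (x⊓y≤y ξ (f α)) (proj₂ (unbounded (f α))))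
             (λ ξ<η α → ⊓-monoˡ-< (f α) ξ<η)
    ... | ξ , eq with unbounded ξ
    ... | β , ξ<β = β , downward
      -- Where `β ≤ f α`, stage `β` has the value `β` but stage `ξ` has at most `ξ`, so the two
      -- functions differ.
      (λ {α} β≤f β⊓f≡ξ⊓f → <⇒≱ ξ<β
        (subst (_≤ ξ) (trans (sym β⊓f≡ξ⊓f) (x≤y⇒x⊓y≡x β≤f)) (x⊓y≤x ξ (f α))))
      (eq β (inj₁ ξ<β))

    stabilise⇔bounded : IncreasingSequencesStabilise κ θ I ⇔ FunctionsBounded κ θ I
    stabilise⇔bounded = mk⇔ stabilise⇒bounded bounded⇒stabilise

    recur⇔bounded : PositiveSequencesRecur κ θ I ⇔ FunctionsBounded κ θ I
    recur⇔bounded = mk⇔ recur⇒bounded bounded⇒recur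

    constant⇔bounded : IncreasingFunctionsStabilise κ θ I ⇔ FunctionsBounded κ θ I
    constant⇔bounded = mk⇔ constant⇒bounded bounded⇒constant

    saturated×indecomposable⇔bounded :
      (WeaklySaturated κ θ I × Indecomposable κ θ I) ⇔ FunctionsBounded κ θ I
    saturated×indecomposable⇔bounded = mk⇔ saturated×indecomposable⇒bounded
      λ bdd → bounded⇒saturated bdd , bounded⇒indecomposable bdd

theorem2p6 : (∀ {a} → ExcludedMiddle a) →
    {ℓ i : Level} (κ θ : Ordinal ℓ) →
    IsCardinal κ → IsRegularCardinal θ → θ <ₒ κ →
    (I : Pred (Pred (Ordinal.Carrier κ) ℓ) i) → IsIdeal κ I →
    ((WeaklySaturated κ θ I × Indecomposable κ θ I) ⇔ IncreasingSequencesStabilise κ θ I) ×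
    (IncreasingSequencesStabilise κ θ I ⇔ PositiveSequencesRecur κ θ I) ×
    (PositiveSequencesRecur κ θ I ⇔ IncreasingFunctionsStabilise κ θ I) ×
    (IncreasingFunctionsStabilise κ θ I ⇔ FunctionsBounded κ θ I)
theorem2p6 em κ θ _ θ-regular _ I I-ideal =
    via saturated×indecomposable⇔bounded stabilise⇔bounded
  , via stabilise⇔bounded recur⇔bounded
  , via recur⇔bounded constant⇔bounded
  , constant⇔bounded
  where
  open Equivalences em κ θ θ-regular I I-ideal
  via : ∀ {a b c} {A : Set a} {B : Set b} {C : Set c} → A ⇔ C → B ⇔ C → A ⇔ B
  via A⇔C B⇔C = Composition.equivalence A⇔C (Symmetry.equivalence B⇔C)
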